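{- Consider the transposition game on the domain $D=\{1,\dots,d\}$ with an initial sequence of $m$ distinct elements of $D$, with $n$ turns to be played ($n$ a positive integer), and with $d\ge m+n$. (1) If $d=m+n$, then White wins. (2) If $d>m+n+1$ and, in the initial sequence (that is, with respect to the set $S$ of its elements), - there is no pivot, then White wins; - there is exactly one pivot, then the first player wins; - there is more than one pivot, then Black wins.
   Context: Transposition game: given a domain $D\subset\mathbb{R}$, a finite sequence of $m$ distinct elements of $D$, and a positive integer $n$, with $|D|\ge m+n$. Two players alternate; at each turn the player to move appends to the sequence one element of $D$ not already in it. After $n$ turns the sequence has $m+n$ terms and the game ends. One player wants the parity of the final sequence to be even, the other wants it to be odd (which player has which goal is fixed before the game starts). The parity of a finite sequence of distinct reals is the parity (mod 2) of the number of transpositions needed to put it in order. Black is the player who plays the last turn, and White is the player who plays the second last turn; so if $n$ is odd Black is the first player, and if $n$ is even White is the first player. "A player wins" means that this player has a winning strategy. $S$ denotes the set of elements already in the sequence; elements of $D\setminus S$ are called free. For $a,b\in S$, write $a\sim_S b$ if $[a,b]\cap D\subset S$, where $[a,b]$ is the closed interval with endpoints $a$ and $b$; this is an equivalence relation and its classes are the $S$-blocks. A pivot is an $S$-block with an odd number of elements such that there exist two free elements, one of which is smaller and the other larger than the elements of the block.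
   Formalization: The claims "if d=m+n, then White wins" and "no pivot, then White wins" are stated only for n ≥ 2: for n = 1 White has no turn and the parity is forced, so they fail, e.g. for D={1} (or {1,2,3}), empty initial sequence, White wanting odd. -}

module Defs where

open import Data.Fin as Fin using (Fin)
open import Data.Fin.Properties using (≤-totalOrder)
open import Data.Fin.Subset as Subset using (Subset; ∣_∣)
open import Data.List using (List; _∷_; _++_; _∷ʳ_; length)
open import Data.List.Membership.Propositional using (_∈_; _∉_)
import Data.List.Relation.Unary.Sorted.TotalOrder as SortedTotalOrder
open import Data.Nat using (ℕ; zero; suc; pred; _<_; NonZero; parity)
open import Data.Parity using (Parity; 1ℙ)
open import Data.Product using (∃; ∃₂; ∃!; _×_; proj₁)
open import Data.Sum using (_⊎_)
open import Function.Bundles using (_⇔_)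
open import Relation.Binary.PropositionalEquality using (_≡_; _≢_)
open import Relation.Nullary using (¬_)

-- The domain D = {1, …, d} is Fin d, where i stands for the integer toℕ i + 1.
-- Only the order of D matters.

data Transposition {A : Set} : List A → List A → Set where
  transpose : ∀ as x bs y cs →
    Transposition (as ++ x ∷ bs ++ y ∷ cs) (as ++ y ∷ bs ++ x ∷ cs)

data Transpositions {A : Set} : ℕ → List A → List A → Set where
  done : ∀ {s} → Transpositions zero s s
  step : ∀ {k s t u} →
    Transposition s t → Transpositions k t u → Transpositions (suc k) s u

Sorted : ∀ {d} → List (Fin d) → Set
Sorted {d} = SortedTotalOrder.Sorted (≤-totalOrder d)

-- For a sequence of distinct elements the parity of k does not depend on
-- how the sequence is put in order.
HasParity : ∀ {d} → List (Fin d) → Parity → Set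
HasParity s p =
  ∃₂ λ k t → Transpositions k s t × Sorted t × parity k ≡ p

data Player : Set where
  Black White : Player

opponent : Player → Player
opponent Black = White
opponent White = Black

-- The player who moves in a turn that is followed by k further turns.
mover : ℕ → Player
mover zero    = Black
mover (suc k) = opponent (mover k)

firstPlayer : ∀ n → .{{NonZero n}} → Player
firstPlayer n = mover (pred n)

-- The current sequence records the whole history of the game. A strategy picks
-- a free element whenever the sequence is too short to exhaust the domain; only
-- its values at the player's own turns are used.
Strategy : ℕ → Set
Strategy d = ∀ (s : List (Fin d)) → length s < d → ∃ λ x → x ∉ s

-- Play σ P k s t: with k turns left from the sequence s, the game can end with
-- the sequence t when P follows σ and the opponent moves arbitrarily.
data Play {d} (σ : Strategy d) (P : Player) :
          ℕ → List (Fin d) → List (Fin d) → Set where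
  end   : ∀ {s} → Play σ P zero s s
  own   : ∀ {k s t} → mover k ≡ P → (free : length s < d) →
          Play σ P k (s ∷ʳ proj₁ (σ s free)) t → Play σ P (suc k) s t
  other : ∀ {k s t} → mover k ≢ P → ∀ x → x ∉ s →
          Play σ P k (s ∷ʳ x) t → Play σ P (suc k) s t

-- goal P is the parity that P wants the final sequence to have.
Wins : ∀ {d} → (Player → Parity) → Player → ℕ → List (Fin d) → Set
Wins {d} goal P n s =
  ∃ λ (σ : Strategy d) → ∀ t → Play σ P n s t → HasParity t (goal P)

Between : ∀ {d} → Fin d → Fin d → Fin d → Set
Between a b x = (a Fin.≤ x × x Fin.≤ b) ⊎ (b Fin.≤ x × x Fin.≤ a)

-- The set S is given by the list s of its elements.
_∼[_]_ : ∀ {d} → Fin d → List (Fin d) → Fin d → Set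
a ∼[ s ] b = ∀ x → Between a b x → x ∈ s

IsBlock : ∀ {d} → List (Fin d) → Subset d → Set
IsBlock s B =
  ∃ λ a → a ∈ s × (∀ b → b Subset.∈ B ⇔ (b ∈ s × a ∼[ s ] b))

IsPivot : ∀ {d} → List (Fin d) → Subset d → Set
IsPivot s B =
  IsBlock s B ×
  parity ∣ B ∣ ≡ 1ℙ ×
  ∃₂ λ x y → x ∉ s × y ∉ s × (∀ b → b Subset.∈ B → x Fin.< b × b Fin.< y)

NoPivot : ∀ {d} → List (Fin d) → Set
NoPivot s = ¬ ∃ (IsPivot s)

ExactlyOnePivot : ∀ {d} → List (Fin d) → Set
ExactlyOnePivot s = ∃! _≡_ (IsPivot s)

MoreThanOnePivot : ∀ {d} → List (Fin d) → Set
MoreThanOnePivot s = ∃₂ λ B C → B ≢ C × IsPivot s B × IsPivot s C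

{-# OPTIONS --safe #-}
module Submission where

-- Give each free element the parity of the number of larger elements in the
-- sequence, and list these bits in increasing order of the free elements.
-- Appending a free element changes the parity of the sequence by its bit,
-- deletes that bit and flips all the bits before it. Two neighbouring free
-- elements have different bits exactly when the block between them is a pivot,
-- so the number of pivots is the number c of changes in the word of bits. A move
-- alters c by at most 1, and
--   * if c ≥ 1 then both parities are available in the last turn, and a player
--     facing at least 5 bits can reach c ≥ 2;
--   * if c ≤ 1 then a player can reach c = 0 by playing one of two bits next to
--     the change (or at the two ends of the word when c = 0), and the choice
--     fixes the parity of this turn and the next one together.
-- Hence Black wins when c ≥ 1 with Black to move or c ≥ 2 with White to move,
-- and White wins when c = 0 with Black to move or c ≤ 1 with White to move,
-- provided White still has a turn. If the domain gets exhausted, White just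
-- decides in which order the last two elements are appended.

open import Defs
open import Data.Bool using (true; false; if_then_else_)
open import Data.Empty using (⊥-elim)
open import Data.Fin as Fin using (Fin; zero; suc)
import Data.Fin.Properties as Finₚ
open import Data.Fin.Subset as Subset using (Subset; ∣_∣; inside; outside; Nonempty)
import Data.Fin.Subset.Properties as Subsetₚ
open import Data.List using (List; []; _∷_; _++_; _∷ʳ_; length; lookup; map; filter; allFin)
open import Data.List.Membership.Propositional using (_∈_; _∉_)
import Data.List.Membership.DecPropositional as DecMembership
open import Data.List.Membership.Propositional.Properties
  using (∈-++⁺ˡ; ∈-++⁺ʳ; ∈-++⁻; ∈-allFin; ∈-filter⁺; ∈-filter⁻; ∈-map⁺; ∈-map⁻)
open import Data.List.Membership.Propositional.Properties.WithK using (unique∧set⇒bag)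
open import Data.List.Properties using (length-++; length-map; length-tabulate)
open import Data.List.Relation.Binary.BagAndSetEquality using (∼bag⇒↭)
open import Data.List.Relation.Binary.Permutation.Propositional as Perm using (_↭_)
open import Data.List.Relation.Binary.Permutation.Propositional.Properties using (↭-length)
open import Data.List.Relation.Unary.All as All using (All; []; _∷_)
open import Data.List.Relation.Unary.AllPairs using (AllPairs; []; _∷_)
import Data.List.Relation.Unary.AllPairs.Properties as AllPairsₚ
open import Data.List.Relation.Unary.Any as Any using (here; there)
open import Data.List.Relation.Unary.Any.Properties using (lookup-index)
open import Data.List.Relation.Unary.Sorted.TotalOrder.Properties using (Sorted⇒AllPairs)
open import Data.List.Relation.Unary.Unique.Propositional using (Unique)
import Data.List.Relation.Unary.Unique.Propositional.Properties as Uniqueₚ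
import Data.List.Sort.InsertionSort as InsertionSort
import Data.List.Sort.InsertionSort.Properties as InsertionSortₚ
open import Data.Nat using (ℕ; zero; suc; _+_; _∸_; _≤_; _<_; _≥_; _>_; z≤n; s≤s; parity; NonZero)
import Data.Nat.Properties as ℕₚ
open import Data.Parity as ℙ using (Parity; 0ℙ; 1ℙ; _⁻¹)
import Data.Parity.Properties as ℙₚ
open import Algebra.Properties.CommutativeSemigroup ℙₚ.+-commutativeSemigroup
  using (interchange; x∙yz≈y∙xz)
open import Data.Product using (∃; ∃₂; _×_; _,_; proj₁; proj₂)
open import Data.Sum using (_⊎_; inj₁; inj₂)
open import Data.Vec as Vec using ([]; _∷_; tabulate)
open import Data.Vec.Properties using (lookup∘tabulate; lookup⇒[]=; []=⇒lookup)
open import Function using (_∘_; _⇔_; mk⇔; module Equivalence)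
open import Function.Properties.Equivalence using () renaming (trans to ⇔-trans; sym to ⇔-sym)
open import Relation.Binary.Definitions using (tri<; tri≈; tri>)
open import Relation.Binary.PropositionalEquality
  using (_≡_; _≢_; refl; sym; trans; cong; cong₂; subst; module ≡-Reasoning)
open import Relation.Nullary using (Dec; yes; no; does; ¬_; ¬?; _×-dec_; _⊎-dec_; _→-dec_)
open import Relation.Nullary.Decidable using (dec-true; dec-false)
open import Relation.Unary using (Decidable)

open Equivalence using (to; from)

-- Words of bits and their changes.

-- A turn, indexed by the bit of the element appended.
data Move : List Parity → Parity → List Parity → Set where
  here  : ∀ {b w} → Move (b ∷ w) b w
  there : ∀ {a b w w′} → Move w b w′ → Move (a ∷ w) b (a ⁻¹ ∷ w′)

Move-length : ∀ {w b w′} → Move w b w′ → length w ≡ suc (length w′)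
Move-length here      = refl
Move-length (there m) = cong suc (Move-length m)

change : Parity → Parity → ℕ
change 0ℙ 0ℙ = 0
change 0ℙ 1ℙ = 1
change 1ℙ 0ℙ = 1
change 1ℙ 1ℙ = 0

changesFrom : Parity → List Parity → ℕ
changesFrom a []      = 0
changesFrom a (b ∷ w) = change a b + changesFrom b w

changes : List Parity → ℕ
changes []      = 0
changes (a ∷ w) = changesFrom a w

-- Flipping the bit in front affects only its comparison with the first bit of `w`.
changesFrom-⁻¹ : ∀ a w → changesFrom a w ≤ suc (changesFrom (a ⁻¹) w)
changesFrom-⁻¹ a  []       = z≤n
changesFrom-⁻¹ 0ℙ (0ℙ ∷ w) = ℕₚ.m≤n+m _ 2
changesFrom-⁻¹ 0ℙ (1ℙ ∷ w) = ℕₚ.≤-refl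
changesFrom-⁻¹ 1ℙ (0ℙ ∷ w) = ℕₚ.≤-refl
changesFrom-⁻¹ 1ℙ (1ℙ ∷ w) = ℕₚ.m≤n+m _ 2

-- Here `b` is deleted and its predecessor `a` flipped. If the two differ, `a ⁻¹` is `b` and exactly
-- one change disappears; if they agree, only the comparison with the bit after `b` is altered.
drop-change : ∀ a b w → changesFrom a (b ∷ w) ≤ suc (changesFrom (a ⁻¹) w)
drop-change 0ℙ 0ℙ w = changesFrom-⁻¹ 0ℙ w
drop-change 0ℙ 1ℙ w = ℕₚ.≤-refl
drop-change 1ℙ 0ℙ w = ℕₚ.≤-refl
drop-change 1ℙ 1ℙ w = changesFrom-⁻¹ 1ℙ w

add-change : ∀ a b w → changesFrom (a ⁻¹) w ≤ suc (changesFrom a (b ∷ w))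
add-change 0ℙ 0ℙ w = changesFrom-⁻¹ 1ℙ w
add-change 0ℙ 1ℙ w = ℕₚ.m≤n+m _ 2
add-change 1ℙ 0ℙ w = ℕₚ.m≤n+m _ 2
add-change 1ℙ 1ℙ w = changesFrom-⁻¹ 0ℙ w

change-≤1 : ∀ a b → change a b ≤ 1
change-≤1 0ℙ 0ℙ = z≤n
change-≤1 0ℙ 1ℙ = s≤s z≤n
change-≤1 1ℙ 0ℙ = s≤s z≤n
change-≤1 1ℙ 1ℙ = z≤n

change-⁻¹ : ∀ a b → change (a ⁻¹) (b ⁻¹) ≡ change a b
change-⁻¹ 0ℙ 0ℙ = refl
change-⁻¹ 0ℙ 1ℙ = refl
change-⁻¹ 1ℙ 0ℙ = refl
change-⁻¹ 1ℙ 1ℙ = refl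

change-≡ : ∀ {a b} → a ≡ b → change a b ≡ 0
change-≡ {0ℙ} refl = refl
change-≡ {1ℙ} refl = refl

change-≢ : ∀ {a b} → a ≢ b → change a b ≡ 1
change-≢ {0ℙ} {0ℙ} a≢b = ⊥-elim (a≢b refl)
change-≢ {0ℙ} {1ℙ} a≢b = refl
change-≢ {1ℙ} {0ℙ} a≢b = refl
change-≢ {1ℙ} {1ℙ} a≢b = ⊥-elim (a≢b refl)

-- Two neighbours before the deleted bit are both flipped, so the change between them persists; the
-- only loss is at the place of the deletion.
changesFrom-Move-≥ : ∀ a {w b w′} → Move w b w′ →
  changesFrom a w ≤ suc (changesFrom (a ⁻¹) w′)
changesFrom-Move-≥ a (here {b} {w}) = drop-change a b w
changesFrom-Move-≥ a (there {c} {w′ = w′} m) rewrite change-⁻¹ a c =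
  ℕₚ.≤-trans (ℕₚ.+-monoʳ-≤ (change a c) (changesFrom-Move-≥ c m))
             (ℕₚ.≤-reflexive (ℕₚ.+-suc (change a c) _))

changesFrom-Move-≤ : ∀ a {w b w′} → Move w b w′ →
  changesFrom (a ⁻¹) w′ ≤ suc (changesFrom a w)
changesFrom-Move-≤ a (here {b} {w}) = add-change a b w
changesFrom-Move-≤ a (there {c} {w = w} m) rewrite change-⁻¹ a c =
  ℕₚ.≤-trans (ℕₚ.+-monoʳ-≤ (change a c) (changesFrom-Move-≤ c m))
             (ℕₚ.≤-reflexive (ℕₚ.+-suc (change a c) _))

-- Deleting the first bit flips nothing and loses at most the change behind it; any other move flips
-- the first bit, as in `changesFrom-Move-≥`.
changes-Move-≥ : ∀ {w b w′} → Move w b w′ → changes w ≤ suc (changes w′)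
changes-Move-≥ (here {w = []})    = z≤n
changes-Move-≥ (here {b} {c ∷ w}) = ℕₚ.+-monoˡ-≤ (changesFrom c w) (change-≤1 b c)
changes-Move-≥ (there {a} m)      = changesFrom-Move-≥ a m

changes-Move-≤ : ∀ {w b w′} → Move w b w′ → changes w′ ≤ suc (changes w)
changes-Move-≤ (here {w = []})    = z≤n
changes-Move-≤ (here {b} {c ∷ w}) = ℕₚ.≤-trans (ℕₚ.m≤n+m _ (change b c)) (ℕₚ.n≤1+n _)
changes-Move-≤ (there {a} m)      = changesFrom-Move-≤ a m

constant : ∀ a w → changesFrom a w ≡ 0 → All (_≡ a) w
constant a  []       c = []
constant 0ℙ (0ℙ ∷ w) c = refl ∷ constant 0ℙ w c
constant 1ℙ (1ℙ ∷ w) c = refl ∷ constant 1ℙ w c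

All-Move : ∀ {a w b w′} → All (_≡ a) w → Move w b w′ → b ≡ a
All-Move (b≡a ∷ _)  here      = b≡a
All-Move (_   ∷ pw) (there m) = All-Move pw m

constant⇒changesFrom≡0 : ∀ a {w} → All (_≡ a) w → changesFrom a w ≡ 0
constant⇒changesFrom≡0 a  []          = refl
constant⇒changesFrom≡0 0ℙ (refl ∷ pw) = constant⇒changesFrom≡0 0ℙ pw
constant⇒changesFrom≡0 1ℙ (refl ∷ pw) = constant⇒changesFrom≡0 1ℙ pw

constant⇒changes≡0 : ∀ {a w} → All (_≡ a) w → changes w ≡ 0
constant⇒changes≡0 []          = refl
constant⇒changes≡0 (refl ∷ pw) = constant⇒changesFrom≡0 _ pw

-- Deleting the last bit of the first run flips the earlier bits of that run to `a ⁻¹`, the value of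
-- the second run if there is one.
end-of-first-run : ∀ a w → changesFrom a w ≤ 1 →
  ∃ λ w′ → Move (a ∷ w) a w′ × All (_≡ a ⁻¹) w′
end-of-first-run a [] c = [] , here , []
end-of-first-run 0ℙ (0ℙ ∷ w) c with w′ , m , pw ← end-of-first-run 0ℙ w c =
  1ℙ ∷ w′ , there m , refl ∷ pw
end-of-first-run 1ℙ (1ℙ ∷ w) c with w′ , m , pw ← end-of-first-run 1ℙ w c =
  0ℙ ∷ w′ , there m , refl ∷ pw
end-of-first-run 0ℙ (1ℙ ∷ w) (s≤s c) =
  1ℙ ∷ w , here , refl ∷ constant 1ℙ w (ℕₚ.n≤0⇒n≡0 c)
end-of-first-run 1ℙ (0ℙ ∷ w) (s≤s c) =
  0ℙ ∷ w , here , refl ∷ constant 0ℙ w (ℕₚ.n≤0⇒n≡0 c)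

-- Deleting the first bit of the second run flips the whole first run to the value of what remains.
start-of-second-run : ∀ a w → changesFrom a w ≡ 1 →
  ∃ λ w′ → Move (a ∷ w) (a ⁻¹) w′ × All (_≡ a ⁻¹) w′
start-of-second-run 0ℙ (0ℙ ∷ w) c with w′ , m , pw ← start-of-second-run 0ℙ w c =
  1ℙ ∷ w′ , there m , refl ∷ pw
start-of-second-run 1ℙ (1ℙ ∷ w) c with w′ , m , pw ← start-of-second-run 1ℙ w c =
  0ℙ ∷ w′ , there m , refl ∷ pw
start-of-second-run 0ℙ (1ℙ ∷ w) c =
  1ℙ ∷ w , there here , refl ∷ constant 1ℙ w (ℕₚ.suc-injective c)
start-of-second-run 1ℙ (0ℙ ∷ w) c =
  0ℙ ∷ w , there here , refl ∷ constant 0ℙ w (ℕₚ.suc-injective c)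

-- The next turn has to pay `e`, so `b ℙ.+ e` is the joint contribution of two turns. It is odd on
-- deleting the end of the first run, even on deleting the start of the second run or the first bit
-- of a constant word.
move-to-constant : ∀ q w → 1 ≤ length w → changes w ≤ 1 →
  ∃₂ λ b w′ → Move w b w′ × (∃ λ e → All (_≡ e) w′ × b ℙ.+ e ≡ q)
move-to-constant 1ℙ (a ∷ w) _ c with w′ , m , pw ← end-of-first-run a w c =
  a , w′ , m , a ⁻¹ , pw , ℙₚ.p+p⁻¹≡1ℙ a
move-to-constant 0ℙ (a ∷ w) _ c with changesFrom a w in eq
move-to-constant 0ℙ (a ∷ w) _ z≤n | 0 =
  a , w , here , a , constant a w eq , ℙₚ.p+p≡0ℙ a
move-to-constant 0ℙ (a ∷ w) _ (s≤s z≤n) | 1 with w′ , m , pw ← start-of-second-run a w eq =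
  a ⁻¹ , w′ , m , a ⁻¹ , pw , ℙₚ.p+p≡0ℙ (a ⁻¹)

-- A change makes both values occur, and a move may delete any occurrence.
pay-any : ∀ q a w → 1 ≤ changesFrom a w → ∃ λ w′ → Move (a ∷ w) q w′
pay-any 0ℙ 0ℙ w c = w , here
pay-any 1ℙ 1ℙ w c = w , here
pay-any 1ℙ 0ℙ (0ℙ ∷ w) c with w′ , m ← pay-any 1ℙ 0ℙ w c = 1ℙ ∷ w′ , there m
pay-any 1ℙ 0ℙ (1ℙ ∷ w) c = 1ℙ ∷ w , there here
pay-any 0ℙ 1ℙ (0ℙ ∷ w) c = 0ℙ ∷ w , there here
pay-any 0ℙ 1ℙ (1ℙ ∷ w) c with w′ , m ← pay-any 0ℙ 1ℙ w c = 0ℙ ∷ w′ , there m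

pattern by₁ c = _ , _ , here , c
pattern by₂ c = _ , _ , there here , c
pattern by₃ c = _ , _ , there (there here) , c
pattern by₄ c = _ , _ , there (there (there here)) , c
pattern by₅ c = _ , _ , there (there (there (there here))) , c
pattern two = s≤s (s≤s z≤n)

-- The middle one of three equal bits is isolated by its flipped predecessor;
-- otherwise two changes are already visible in what remains of the first five bits.
move-to-two-changes : ∀ w → 5 ≤ length w → 1 ≤ changes w →
  ∃₂ λ b w′ → Move w b w′ × 2 ≤ changes w′
move-to-two-changes [] ()
move-to-two-changes (_ ∷ []) (s≤s ())
move-to-two-changes (_ ∷ _ ∷ []) (s≤s (s≤s ()))
move-to-two-changes (_ ∷ _ ∷ _ ∷ []) (s≤s (s≤s (s≤s ())))
move-to-two-changes (_ ∷ _ ∷ _ ∷ _ ∷ []) (s≤s (s≤s (s≤s (s≤s ()))))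
move-to-two-changes (0ℙ ∷ 0ℙ ∷ 0ℙ ∷ _) _ c = by₂ (s≤s c)
move-to-two-changes (0ℙ ∷ 0ℙ ∷ 1ℙ ∷ 0ℙ ∷ _) _ c = by₁ two
move-to-two-changes (0ℙ ∷ 0ℙ ∷ 1ℙ ∷ 1ℙ ∷ 0ℙ ∷ _) _ c = by₁ two
move-to-two-changes (0ℙ ∷ 0ℙ ∷ 1ℙ ∷ 1ℙ ∷ 1ℙ ∷ _) _ c = by₄ two
move-to-two-changes (0ℙ ∷ 1ℙ ∷ 0ℙ ∷ 0ℙ ∷ _) _ c = by₄ two
move-to-two-changes (0ℙ ∷ 1ℙ ∷ 0ℙ ∷ 1ℙ ∷ _) _ c = by₁ two
move-to-two-changes (0ℙ ∷ 1ℙ ∷ 1ℙ ∷ 0ℙ ∷ 0ℙ ∷ _) _ c = by₅ two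
move-to-two-changes (0ℙ ∷ 1ℙ ∷ 1ℙ ∷ 0ℙ ∷ 1ℙ ∷ _) _ c = by₁ two
move-to-two-changes (0ℙ ∷ 1ℙ ∷ 1ℙ ∷ 1ℙ ∷ _) _ c = by₃ two
move-to-two-changes (1ℙ ∷ 0ℙ ∷ 0ℙ ∷ 0ℙ ∷ _) _ c = by₃ two
move-to-two-changes (1ℙ ∷ 0ℙ ∷ 0ℙ ∷ 1ℙ ∷ 0ℙ ∷ _) _ c = by₁ two
move-to-two-changes (1ℙ ∷ 0ℙ ∷ 0ℙ ∷ 1ℙ ∷ 1ℙ ∷ _) _ c = by₅ two
move-to-two-changes (1ℙ ∷ 0ℙ ∷ 1ℙ ∷ 0ℙ ∷ _) _ c = by₁ two
move-to-two-changes (1ℙ ∷ 0ℙ ∷ 1ℙ ∷ 1ℙ ∷ _) _ c = by₄ two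
move-to-two-changes (1ℙ ∷ 1ℙ ∷ 0ℙ ∷ 0ℙ ∷ 0ℙ ∷ _) _ c = by₄ two
move-to-two-changes (1ℙ ∷ 1ℙ ∷ 0ℙ ∷ 0ℙ ∷ 1ℙ ∷ _) _ c = by₁ two
move-to-two-changes (1ℙ ∷ 1ℙ ∷ 0ℙ ∷ 1ℙ ∷ _) _ c = by₁ two
move-to-two-changes (1ℙ ∷ 1ℙ ∷ 1ℙ ∷ _) _ c = by₂ (s≤s c)

-- Winning strategies for the game on words.

-- The game on words of bits: k turns are left, q is the parity accumulated so far.
data Forces (goal : Player → Parity) (P : Player) : ℕ → Parity → List Parity → Set where
  end   : ∀ {q w} → q ≡ goal P → Forces goal P zero q w
  own   : ∀ {k q w b w′} → mover k ≡ P → Move w b w′ →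
          Forces goal P k (q ℙ.+ b) w′ → Forces goal P (suc k) q w
  other : ∀ {k q w} → mover k ≢ P →
          (∀ {b w′} → Move w b w′ → Forces goal P k (q ℙ.+ b) w′) →
          Forces goal P (suc k) q w

_≟ᴾ_ : ∀ (P Q : Player) → Dec (P ≡ Q)
Black ≟ᴾ Black = yes refl
Black ≟ᴾ White = no λ ()
White ≟ᴾ Black = no λ ()
White ≟ᴾ White = yes refl

opponent-selfInverse : ∀ {P Q} → opponent P ≡ Q → P ≡ opponent Q
opponent-selfInverse {Black} refl = refl
opponent-selfInverse {White} refl = refl

≢-moves : ∀ {k P Q} → mover k ≡ P → P ≢ Q → mover k ≢ Q
≢-moves refl P≢Q = P≢Q

p+[p+q]≡q : ∀ p q → p ℙ.+ (p ℙ.+ q) ≡ q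
p+[p+q]≡q 0ℙ q = refl
p+[p+q]≡q 1ℙ q = ℙₚ.⁻¹-involutive q

Move-length-≤ : ∀ {k w b w′} → Move w b w′ → suc k ≤ length w → k ≤ length w′
Move-length-≤ m k<w = ℕₚ.≤-pred (subst (_ ≤_) (Move-length m) k<w)

module _ (goal : Player → Parity) where

  -- A white move destroys at most one of two changes, and Black can restore the second. The surplus
  -- of two bits over the turns left persists, as each turn deletes one bit.
  black-forces-moving-first : ∀ k {q w} → mover k ≡ Black → suc k + 2 ≤ length w →
    1 ≤ changes w → Forces goal Black (suc k) q w
  black-forces-moving-second : ∀ k {q w} → mover k ≡ White → suc k + 2 ≤ length w →
    2 ≤ changes w → Forces goal Black (suc k) q w

  black-forces-moving-first zero {q} {a ∷ w} b _ c
    with w′ , m ← pay-any (q ℙ.+ goal Black) a w c = own b m (end (p+[p+q]≡q q (goal Black)))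
  black-forces-moving-first (suc k@(suc _)) {w = w} b l c =
    -- Black has an odd number of turns left, more than one, hence at least three; with the surplus
    -- the word has at least five bits.
    let _ , _ , m , c′ = move-to-two-changes w (ℕₚ.≤-trans (ℕₚ.+-monoˡ-≤ 2 (s≤s (s≤s (s≤s z≤n)))) l) c
    in own b m (black-forces-moving-second k (opponent-selfInverse b) (Move-length-≤ m l) c′)

  black-forces-moving-second (suc k) b l c = other (≢-moves {suc k} b λ ()) λ m →
    black-forces-moving-first k (opponent-selfInverse b) (Move-length-≤ m l)
      (ℕₚ.≤-pred (ℕₚ.≤-trans c (changes-Move-≥ m)))

  -- White makes the word constant at every own turn, and a black move then creates at most one
  -- change. White's last turn settles the parity of the final two turns. In the second statement
  -- `1 ≤ k` guarantees White a turn.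
  white-forces-moving-first : ∀ k {q w} → mover k ≡ White → suc k ≤ length w →
    changes w ≤ 1 → Forces goal White (suc k) q w
  white-forces-moving-second : ∀ k {q w} → mover k ≡ Black → 1 ≤ k → suc k ≤ length w →
    changes w ≡ 0 → Forces goal White (suc k) q w

  white-forces-moving-first (suc k) {q} {w} b l c
    -- The target is what the final two turns must contribute together; in earlier turns only the
    -- constancy of the new word is used.
    with move-to-constant (q ℙ.+ goal White) w (ℕₚ.≤-trans (s≤s z≤n) l) c
  white-forces-moving-first (suc zero) {q} b l c | p , _ , m , e , pw , p+e≡q+g =
    own b m (other (λ ()) λ m′ → end (trans (cong (q ℙ.+ p ℙ.+_) (All-Move pw m′))
      (trans (ℙₚ.+-assoc q p e) (trans (cong (q ℙ.+_) p+e≡q+g) (p+[p+q]≡q q (goal White))))))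
  white-forces-moving-first (suc k@(suc (suc _))) b l c | _ , _ , m , _ , pw , _ =
    own b m (white-forces-moving-second k (opponent-selfInverse b) (s≤s z≤n) (Move-length-≤ m l)
      (constant⇒changes≡0 pw))

  white-forces-moving-second (suc k) {w = w} b _ l c = other (≢-moves {suc k} b λ ()) λ m →
    white-forces-moving-first k (opponent-selfInverse b) (Move-length-≤ m l)
      (subst (λ n → _ ≤ suc n) c (changes-Move-≤ m))

  -- If every move succeeds, it does not matter who moves; `m₀` is the move made when it is the turn
  -- of `P`.
  any-turn : ∀ {P k q w b₀ w₀} → Move w b₀ w₀ →
    (∀ {q b w′} → Move w b w′ → Forces goal P k q w′) → Forces goal P (suc k) q w
  any-turn {P} {k} m₀ f with mover k ≟ᴾ P
  ... | yes k≡P = own k≡P m₀ (f m₀)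
  ... | no  k≢P = other k≢P λ m → f m

  -- When only `a` and `b` are left, the two orders contribute `a ℙ.+ b` and `b ℙ.+ a ⁻¹`, which
  -- have opposite parities, and White chooses. Before that any move will do.
  white-forces-full-board : ∀ k {q w} → 1 ≤ k → length w ≡ suc k → Forces goal White (suc k) q w
  white-forces-full-board (suc zero) {q} {a ∷ b ∷ []} _ l with a ℙ.+ b ℙₚ.≟ q ℙ.+ goal White
  ... | yes a+b≡ = own refl here (other (λ ()) λ { here → end
        (trans (ℙₚ.+-assoc q a b) (trans (cong (q ℙ.+_) a+b≡) (p+[p+q]≡q q (goal White)))) })
  ... | no  a+b≢ = own refl (there here) (other (λ ()) λ { here → end (trans (ℙₚ.+-assoc q b (a ⁻¹))
        (trans (cong (q ℙ.+_) (other-order a b _ a+b≢)) (p+[p+q]≡q q (goal White)))) })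
    where
    other-order : ∀ a b p → a ℙ.+ b ≢ p → b ℙ.+ a ⁻¹ ≡ p
    other-order 0ℙ 0ℙ 0ℙ n = ⊥-elim (n refl)
    other-order 0ℙ 0ℙ 1ℙ n = refl
    other-order 0ℙ 1ℙ 0ℙ n = refl
    other-order 0ℙ 1ℙ 1ℙ n = ⊥-elim (n refl)
    other-order 1ℙ 0ℙ 0ℙ n = refl
    other-order 1ℙ 0ℙ 1ℙ n = ⊥-elim (n refl)
    other-order 1ℙ 1ℙ 0ℙ n = ⊥-elim (n refl)
    other-order 1ℙ 1ℙ 1ℙ n = refl
  white-forces-full-board (suc k@(suc _)) {w = a ∷ w} _ l = any-turn here λ m →
    white-forces-full-board k (s≤s z≤n) (ℕₚ.suc-injective (trans (sym (Move-length m)) l))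

-- Counting modulo 2.

indicator : ∀ {A : Set} → Dec A → Parity
indicator A? = if does A? then 1ℙ else 0ℙ

indicator-yes : ∀ {A : Set} (A? : Dec A) → A → indicator A? ≡ 1ℙ
indicator-yes A? a rewrite dec-true A? a = refl

indicator-no : ∀ {A : Set} (A? : Dec A) → ¬ A → indicator A? ≡ 0ℙ
indicator-no A? ¬a rewrite dec-false A? ¬a = refl

module _ {A : Set} {P : A → Set} (P? : Decidable P) where

  countParity : List A → Parity
  countParity []       = 0ℙ
  countParity (x ∷ xs) = indicator (P? x) ℙ.+ countParity xs

  countParity-∷ʳ : ∀ xs x → countParity (xs ∷ʳ x) ≡ countParity xs ℙ.+ indicator (P? x)
  countParity-∷ʳ []       x = ℙₚ.+-comm (indicator (P? x)) 0ℙ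
  countParity-∷ʳ (y ∷ xs) x = trans (cong (indicator (P? y) ℙ.+_) (countParity-∷ʳ xs x))
    (sym (ℙₚ.+-assoc (indicator (P? y)) _ _))

  countParity-↭ : ∀ {xs ys} → xs ↭ ys → countParity xs ≡ countParity ys
  countParity-↭ Perm.refl          = refl
  countParity-↭ (Perm.prep x p)   = cong (indicator (P? x) ℙ.+_) (countParity-↭ p)
  countParity-↭ (Perm.swap x y p) = trans (x∙yz≈y∙xz (indicator (P? x)) (indicator (P? y)) _)
    (cong (λ c → indicator (P? y) ℙ.+ (indicator (P? x) ℙ.+ c)) (countParity-↭ p))
  countParity-↭ (Perm.trans p q)  = trans (countParity-↭ p) (countParity-↭ q)

  countParity-none : ∀ {xs} → All (¬_ ∘ P) xs → countParity xs ≡ 0ℙ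
  countParity-none []         = refl
  countParity-none (¬p ∷ ¬ps) = cong₂ ℙ._+_ (indicator-no (P? _) ¬p) (countParity-none ¬ps)

-- Transpositions and inversions.

parity-suc : ∀ n → parity (suc n) ≡ 1ℙ ℙ.+ parity n
parity-suc = ℙₚ.+-homo-+ 1

module _ {A : Set} where

  Transposition-∷ : ∀ (x : A) {s t} → Transposition s t → Transposition (x ∷ s) (x ∷ t)
  Transposition-∷ x (transpose as y bs z cs) = transpose (x ∷ as) y bs z cs

  Transpositions-∷ : ∀ (x : A) {k s t} → Transpositions k s t → Transpositions k (x ∷ s) (x ∷ t)
  Transpositions-∷ x done        = done
  Transpositions-∷ x (step τ τs) = step (Transposition-∷ x τ) (Transpositions-∷ x τs)

  Transpositions-trans : ∀ {j k} {s t u : List A} →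
    Transpositions j s t → Transpositions k t u → Transpositions (j + k) s u
  Transpositions-trans done        σs = σs
  Transpositions-trans (step τ τs) σs = step τ (Transpositions-trans τs σs)

module _ {d : ℕ} where

  open InsertionSort (Finₚ.≤-decTotalOrder d) using (insert; sort)
  open InsertionSortₚ (Finₚ.≤-decTotalOrder d) using (sort-↭; sort-↗)
  open DecMembership (Finₚ._≟_ {d}) using (_∈?_; _∉?_)

  inversions : List (Fin d) → Parity
  inversions []      = 0ℙ
  inversions (x ∷ s) = countParity (Finₚ._<? x) s ℙ.+ inversions s

  greater : List (Fin d) → Fin d → Parity
  greater s x = countParity (x Finₚ.<?_) s

  -- The last term forms inversions exactly with the greater terms before it, so a turn adds its bit
  -- to the parity.
  inversions-∷ʳ : ∀ s x → inversions (s ∷ʳ x) ≡ inversions s ℙ.+ greater s x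
  inversions-∷ʳ []      x = refl
  inversions-∷ʳ (y ∷ s) x = trans
    (cong₂ ℙ._+_ (countParity-∷ʳ (Finₚ._<? y) s x) (inversions-∷ʳ s x))
    (interchange (countParity (Finₚ._<? y) s) _ (inversions s) _)

  -- Each step of `x` past a smaller element is one transposition, and in a sorted list no smaller
  -- element follows the place where the insertion stops.
  insert-transpositions : ∀ x {s} → AllPairs Fin._≤_ s →
    ∃ λ k → Transpositions k (x ∷ s) (insert x s) × parity k ≡ countParity (Finₚ._<? x) s
  insert-transpositions x [] = 0 , done , refl
  insert-transpositions x {y ∷ s} (y≤s ∷ ps) with x Finₚ.≤? y
  ... | yes x≤y rewrite dec-true (x Finₚ.≤? y) x≤y = 0 , done , sym (countParity-none (Finₚ._<? x)
          (All.map (λ x≤z z<x → ℕₚ.<⇒≱ z<x x≤z) (x≤y ∷ All.map (ℕₚ.≤-trans x≤y) y≤s)))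
  ... | no  x≰y rewrite dec-false (x Finₚ.≤? y) x≰y
    with k , τs , pk ← insert-transpositions x ps =
        suc k , step (transpose [] x [] y s) (Transpositions-∷ y τs) ,
        trans (parity-suc k) (cong₂ ℙ._+_ (sym (indicator-yes (y Finₚ.<? x) (ℕₚ.≰⇒> x≰y))) pk)

  sort-transpositions : ∀ s → ∃ λ k → Transpositions k s (sort s) × parity k ≡ inversions s
  sort-transpositions []      = 0 , done , refl
  sort-transpositions (x ∷ s)
    with j , τs , pj ← sort-transpositions s
    with k , σs , pk ← insert-transpositions x (Sorted⇒AllPairs (Finₚ.≤-totalOrder d) (sort-↗ s)) =
    j + k , Transpositions-trans (Transpositions-∷ x τs) σs ,
    trans (ℙₚ.+-homo-+ j k) (trans (ℙₚ.+-comm (parity j) (parity k))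
      -- Sorting permutes the tail and so keeps the number of its elements below `x`.
      (cong₂ ℙ._+_ (trans pk (countParity-↭ (Finₚ._<? x) (sort-↭ s))) pj))

  hasParity : ∀ s → HasParity s (inversions s)
  hasParity s with k , τs , pk ← sort-transpositions s = k , sort s , τs , sort-↗ s , pk

  -- From winning positions to strategies.

  exists-free : ∀ (s : List (Fin d)) → length s < d → ∃ λ x → x ∉ s
  exists-free s l = Finₚ.¬∀⟶∃¬ d (_∈ s) (_∈? s) λ all →
    let i , j , i<j , eq = Finₚ.pigeonhole l (λ x → Any.index (all x))
    in ℕₚ.<⇒≢ i<j (cong Fin.toℕ (trans (lookup-index (all i))
         (trans (cong (lookup s) eq) (sym (lookup-index (all j))))))

  module _ (goal : Player → Parity) (P : Player) where

    -- Backward induction over the turns. It is decidable because `Fin d` is finite, so a strategy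
    -- can search for a good element anew at each turn.
    Winning : ℕ → List (Fin d) → Set
    Winning zero    s = inversions s ≡ goal P
    Winning (suc k) s =
      (mover k ≡ P × ∃ λ x → x ∉ s × Winning k (s ∷ʳ x)) ⊎
      (mover k ≢ P × ∀ x → x ∉ s → Winning k (s ∷ʳ x))

    winning? : ∀ k s → Dec (Winning k s)
    winning? zero    s = inversions s ℙₚ.≟ goal P
    winning? (suc k) s =
      (mover k ≟ᴾ P ×-dec Finₚ.any? λ x → (x ∉? s) ×-dec winning? k (s ∷ʳ x)) ⊎-dec
      (¬? (mover k ≟ᴾ P) ×-dec Finₚ.all? λ x → (x ∉? s) →-dec winning? k (s ∷ʳ x))

    -- N is the final length, from which a strategy recovers the number of turns left.
    module _ (N : ℕ) where

      Good : List (Fin d) → Fin d → Set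
      Good s x = x ∉ s × Winning (N ∸ suc (length s)) (s ∷ʳ x)

      good? : ∀ s → Dec (∃ (Good s))
      good? s = Finₚ.any? λ x → (x ∉? s) ×-dec winning? (N ∸ suc (length s)) (s ∷ʳ x)

      strategy : Strategy d
      strategy s l with good? s
      ... | yes (x , x∉s , _) = x , x∉s
      -- Default value: without a good element any free one is taken. At the turns of `P` in a play
      -- from a winning position this does not occur.
      ... | no _              = exists-free s l

      strategy-good : ∀ s l → ∃ (Good s) → Good s (proj₁ (strategy s l))
      strategy-good s l g with good? s
      ... | yes (x , good) = good
      ... | no ¬g          = ⊥-elim (¬g g)

      length-∷ʳ : ∀ {k} (s : List (Fin d)) x → suc k + length s ≡ N → k + length (s ∷ʳ x) ≡ N
      length-∷ʳ {k} s x eq = trans (cong (k +_) (trans (length-++ s) (ℕₚ.+-comm _ 1)))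
        (trans (ℕₚ.+-suc k _) eq)

      -- Every turn preserves `k + length s ≡ N`, so the number of turns that `strategy` computes
      -- from the length is the true one.
      Winning⇒HasParity : ∀ {k s t} → k + length s ≡ N → Winning k s →
        Play strategy P k s t → HasParity t (goal P)
      Winning⇒HasParity eq w end = subst (HasParity _) w (hasParity _)
      Winning⇒HasParity {suc k} {s} eq (inj₁ (_ , x , x∉s , w)) (own _ l p) =
        Winning⇒HasParity (length-∷ʳ s _ eq)
          (subst (λ n → Winning n _) turns
            (proj₂ (strategy-good s l (x , x∉s , subst (λ n → Winning n _) (sym turns) w)))) p
        where
        turns : N ∸ suc (length s) ≡ k
        turns = trans (cong (_∸ suc (length s)) (trans (sym eq) (sym (ℕₚ.+-suc k _)))) (ℕₚ.m+n∸n≡m k (suc (length s)))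
      Winning⇒HasParity eq (inj₁ (≡P , _)) (other ≢P _ _ _) = ⊥-elim (≢P ≡P)
      Winning⇒HasParity eq (inj₂ (≢P , _)) (own ≡P _ _)     = ⊥-elim (≢P ≡P)
      Winning⇒HasParity {s = s} eq (inj₂ (_ , f)) (other _ x x∉s p) =
        Winning⇒HasParity (length-∷ʳ s x eq) (f x x∉s) p

    Winning⇒Wins : ∀ {k s} → Winning k s → Wins goal P k s
    Winning⇒Wins {k} {s} w =
      strategy (k + length s) , λ t → Winning⇒HasParity (k + length s) refl w

  -- From sequences to words of bits.

  ∉-∷ʳ : ∀ {x y : Fin d} {s} → y ∉ s → y ≢ x → y ∉ s ∷ʳ x
  ∉-∷ʳ {s = s} y∉s y≢x y∈ with ∈-++⁻ s y∈
  ... | inj₁ y∈s        = y∉s y∈s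
  ... | inj₂ (here y≡x) = y≢x y≡x

  -- The list `l` stands for a part of the domain, so that the effect of a turn can be followed by
  -- induction along it.
  bitsOf : List (Fin d) → List (Fin d) → List Parity
  bitsOf s l = map (greater s) (filter (_∉? s) l)

  bits : List (Fin d) → List Parity
  bits s = bitsOf s (allFin d)

  greater-∷ʳ-< : ∀ s {x y} → y Fin.< x → greater (s ∷ʳ x) y ≡ greater s y ⁻¹
  greater-∷ʳ-< s {x} {y} y<x rewrite countParity-∷ʳ (y Finₚ.<?_) s x | indicator-yes (y Finₚ.<? x) y<x =
    ℙₚ.+-comm (greater s y) 1ℙ

  greater-∷ʳ-≮ : ∀ s {x y} → ¬ y Fin.< x → greater (s ∷ʳ x) y ≡ greater s y
  greater-∷ʳ-≮ s {x} {y} y≮x rewrite countParity-∷ʳ (y Finₚ.<?_) s x | indicator-no (y Finₚ.<? x) y≮x =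
    ℙₚ.+-identityʳ (greater s y)

  bitsOf-∷-∈ : ∀ {s y} l → y ∈ s → bitsOf s (y ∷ l) ≡ bitsOf s l
  bitsOf-∷-∈ {s} {y} l y∈s rewrite dec-false (y ∉? s) (λ y∉s → y∉s y∈s) = refl

  bitsOf-∷-∉ : ∀ {s y} l → y ∉ s → bitsOf s (y ∷ l) ≡ greater s y ∷ bitsOf s l
  bitsOf-∷-∉ {s} {y} l y∉s rewrite dec-true (y ∉? s) y∉s = refl

  bitsOf-above : ∀ s {x l} → All (x Fin.<_) l → bitsOf (s ∷ʳ x) l ≡ bitsOf s l
  bitsOf-above s [] = refl
  bitsOf-above s {x} {y ∷ l} (x<y ∷ x<l) with y ∈? s
  ... | yes y∈s = trans (bitsOf-∷-∈ l (∈-++⁺ˡ y∈s)) (bitsOf-above s x<l)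
  ... | no  y∉s = trans (bitsOf-∷-∉ l (∉-∷ʳ y∉s (λ y≡x → ℕₚ.<⇒≢ x<y (cong Fin.toℕ (sym y≡x)))))
        (cong₂ _∷_ (greater-∷ʳ-≮ s (ℕₚ.<-asym x<y)) (bitsOf-above s x<l))

  bitsOf-at : ∀ s {x l} → All (x Fin.<_) l → bitsOf (s ∷ʳ x) (x ∷ l) ≡ bitsOf s l
  bitsOf-at s {x} {l} x<l = trans (bitsOf-∷-∈ l (∈-++⁺ʳ s (here refl))) (bitsOf-above s x<l)

  bitsOf-below : ∀ s {x y} l → y ∉ s → y Fin.< x →
    bitsOf (s ∷ʳ x) (y ∷ l) ≡ greater s y ⁻¹ ∷ bitsOf (s ∷ʳ x) l
  bitsOf-below s l y∉s y<x = trans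
    (bitsOf-∷-∉ l (∉-∷ʳ y∉s (λ y≡x → ℕₚ.<⇒≢ y<x (cong Fin.toℕ y≡x))))
    (cong (_∷ _) (greater-∷ʳ-< s y<x))

  -- In a sorted list the elements before `x` are smaller, so their bits flip; the later ones keep
  -- their bits, and `x` itself is no longer free.
  append-Move : ∀ s {x l} → AllPairs Fin._<_ l → x ∈ l → x ∉ s →
    Move (bitsOf s l) (greater s x) (bitsOf (s ∷ʳ x) l)
  append-Move s {x} {_ ∷ l} (x<l ∷ _) (here refl) x∉s
    rewrite bitsOf-∷-∉ l x∉s | bitsOf-at s x<l = here
  append-Move s {x} {y ∷ l} (y<l ∷ ps) (there x∈l) x∉s with y ∈? s
  ... | yes y∈s rewrite bitsOf-∷-∈ {s ∷ʳ x} l (∈-++⁺ˡ y∈s) = append-Move s ps x∈l x∉s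
  ... | no  y∉s rewrite bitsOf-below s l y∉s (All.lookup y<l x∈l) = there (append-Move s ps x∈l x∉s)

  -- Each position of the word belongs to a free element, so every move on words is realised by a
  -- turn of the game.
  Move-append : ∀ s {l b w′} → AllPairs Fin._<_ l → Move (bitsOf s l) b w′ →
    ∃ λ x → x ∈ l × x ∉ s × greater s x ≡ b × bitsOf (s ∷ʳ x) l ≡ w′
  Move-append s {y ∷ l} (y<l ∷ ps) m with y ∈? s
  ... | yes y∈s with x , x∈l , x∉s , refl , refl ← Move-append s ps m =
        x , there x∈l , x∉s , refl , bitsOf-∷-∈ l (∈-++⁺ˡ y∈s)
  Move-append s {y ∷ l} (y<l ∷ ps) here | no y∉s = y , here refl , y∉s , refl , bitsOf-at s y<l
  Move-append s {y ∷ l} (y<l ∷ ps) (there m) | no y∉s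
    with x , x∈l , x∉s , refl , refl ← Move-append s ps m =
    x , there x∈l , x∉s , refl , bitsOf-below s l y∉s (All.lookup y<l x∈l)

  allFin-sorted : AllPairs Fin._<_ (allFin d)
  allFin-sorted = AllPairsₚ.tabulate⁺-< λ i<j → i<j

  -- Own moves are lifted by `Move-append`, moves of the opponent are projected by `append-Move`.
  -- Tying `q` and `w` to `s` by equations leaves the indices of `Forces` free for matching.
  Forces⇒Winning : ∀ {goal P k} s {q w} → q ≡ inversions s → w ≡ bits s →
    Forces goal P k q w → Winning goal P k s
  Forces⇒Winning s refl refl (end eq) = eq
  Forces⇒Winning s refl refl (own mv m f)
    with x , _ , x∉s , refl , refl ← Move-append s allFin-sorted m =
    inj₁ (mv , x , x∉s , Forces⇒Winning (s ∷ʳ x) (sym (inversions-∷ʳ s x)) refl f)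
  Forces⇒Winning s refl refl (other mv f) =
    inj₂ (mv , λ x x∉s → Forces⇒Winning (s ∷ʳ x) (sym (inversions-∷ʳ s x)) refl
      (f (append-Move s allFin-sorted (∈-allFin x) x∉s)))

-- Cardinalities of lists and subsets.

-- Without repetitions, lists with equal sets are equal as bags and hence permutations of each
-- other.
unique-length : ∀ {A : Set} {xs ys : List A} → Unique xs → Unique ys →
  (∀ z → z ∈ xs ⇔ z ∈ ys) → length xs ≡ length ys
unique-length uxs uys eq = ↭-length (∼bag⇒↭ (unique∧set⇒bag uxs uys (eq _)))

module _ {A : Set} {P : A → Set} (P? : Decidable P) where

  parity-length-filter : ∀ xs → parity (length (filter P? xs)) ≡ countParity P? xs
  parity-length-filter [] = refl
  parity-length-filter (x ∷ xs) with does (P? x)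
  ... | true  = trans (parity-suc (length (filter P? xs))) (cong (1ℙ ℙ.+_) (parity-length-filter xs))
  ... | false = parity-length-filter xs

elements : ∀ {n} → Subset n → List (Fin n)
elements []            = []
elements (outside ∷ B) = map suc (elements B)
elements (inside  ∷ B) = zero ∷ map suc (elements B)

length-elements : ∀ {n} (B : Subset n) → length (elements B) ≡ ∣ B ∣
length-elements []            = refl
length-elements (outside ∷ B) = trans (length-map suc (elements B)) (length-elements B)
length-elements (inside  ∷ B) = cong suc (trans (length-map suc (elements B)) (length-elements B))

∈-elements⁺ : ∀ {n} {B : Subset n} {z} → z Subset.∈ B → z ∈ elements B
∈-elements⁺ {B = inside  ∷ B} Vec.here        = here refl
∈-elements⁺ {B = inside  ∷ B} (Vec.there z∈B) = there (∈-map⁺ suc (∈-elements⁺ z∈B))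
∈-elements⁺ {B = outside ∷ B} (Vec.there z∈B) = ∈-map⁺ suc (∈-elements⁺ z∈B)

∈-elements⁻ : ∀ {n} {B : Subset n} {z} → z ∈ elements B → z Subset.∈ B
∈-elements⁻ {B = inside ∷ B} (here refl) = Vec.here
∈-elements⁻ {B = inside ∷ B} (there z∈) with _ , y∈ , refl ← ∈-map⁻ suc z∈ = Vec.there (∈-elements⁻ y∈)
∈-elements⁻ {B = outside ∷ B} z∈ with _ , y∈ , refl ← ∈-map⁻ suc z∈ = Vec.there (∈-elements⁻ y∈)

elements-unique : ∀ {n} (B : Subset n) → Unique (elements B)
elements-unique []            = []
elements-unique (outside ∷ B) = Uniqueₚ.map⁺ Finₚ.suc-injective (elements-unique B)
elements-unique (inside  ∷ B) =
  All.tabulate (λ z∈ → λ { refl → case-zero (∈-map⁻ suc z∈) }) ∷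
  Uniqueₚ.map⁺ Finₚ.suc-injective (elements-unique B)
  where
  case-zero : ¬ ∃ λ y → y ∈ elements B × zero ≡ suc y
  case-zero (_ , _ , ())

-- Changes as pairs of consecutive elements.

data Consecutive {A : Set} (x y : A) : List A → Set where
  here  : ∀ {l} → Consecutive x y (x ∷ y ∷ l)
  there : ∀ {z l} → Consecutive x y l → Consecutive x y (z ∷ l)

module _ {A : Set} where

  consecutive-∈ˡ : ∀ {x y : A} {l} → Consecutive x y l → x ∈ l
  consecutive-∈ˡ here      = here refl
  consecutive-∈ˡ (there c) = there (consecutive-∈ˡ c)

  consecutive-∈ʳ : ∀ {x y : A} {l} → Consecutive x y l → y ∈ l
  consecutive-∈ʳ here      = there (here refl)
  consecutive-∈ʳ (there c) = there (consecutive-∈ʳ c)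

  module _ (f : A → Parity) where

    changes-∷ : ∀ z l → changes (map f l) ≤ changes (map f (z ∷ l))
    changes-∷ z []      = z≤n
    changes-∷ z (y ∷ l) = ℕₚ.m≤n+m _ (change (f z) (f y))

    consecutive⇒1≤changes : ∀ {x y l} → Consecutive x y l → f x ≢ f y → 1 ≤ changes (map f l)
    consecutive⇒1≤changes {x} {y} here x≢y rewrite change-≢ x≢y = s≤s z≤n
    consecutive⇒1≤changes (there {z} {l} c) x≢y =
      ℕₚ.≤-trans (consecutive⇒1≤changes c x≢y) (changes-∷ z l)

    consecutive⇒2≤changes : ∀ {x y x′ y′ l} →
      Consecutive x y l → f x ≢ f y → Consecutive x′ y′ l → f x′ ≢ f y′ →
      ¬ (x ≡ x′ × y ≡ y′) → 2 ≤ changes (map f l)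
    consecutive⇒2≤changes here _ here _ n = ⊥-elim (n (refl , refl))
    consecutive⇒2≤changes here p (there c) p′ n rewrite change-≢ p =
      s≤s (consecutive⇒1≤changes c p′)
    consecutive⇒2≤changes (there c) p here p′ n rewrite change-≢ p′ =
      s≤s (consecutive⇒1≤changes c p)
    consecutive⇒2≤changes (there {z} {l} c) p (there c′) p′ n =
      ℕₚ.≤-trans (consecutive⇒2≤changes c p c′ p′ n) (changes-∷ z l)

    1≤changesFrom⇒consecutive : ∀ x l → 1 ≤ changesFrom (f x) (map f l) →
      ∃₂ λ x′ y′ → Consecutive x′ y′ (x ∷ l) × f x′ ≢ f y′
    1≤changesFrom⇒consecutive x (y ∷ l) c with f x ℙₚ.≟ f y
    ... | no  x≢y = x , y , here , x≢y
    ... | yes x≡y rewrite change-≡ x≡y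
      with x′ , y′ , c′ , p ← 1≤changesFrom⇒consecutive y l c = x′ , y′ , there c′ , p

    1≤changes⇒consecutive : ∀ l → 1 ≤ changes (map f l) →
      ∃₂ λ x y → Consecutive x y l × f x ≢ f y
    1≤changes⇒consecutive (x ∷ l) = 1≤changesFrom⇒consecutive x l

    -- Uniqueness makes the left ends differ, and these later tell the two pivots apart.
    2≤changes⇒consecutive : ∀ {l} → Unique l → 2 ≤ changes (map f l) →
      ∃₂ λ x y → ∃₂ λ x′ y′ → Consecutive x y l × f x ≢ f y ×
        Consecutive x′ y′ l × f x′ ≢ f y′ × x ≢ x′
    2≤changes⇒consecutive {x ∷ y ∷ l} (x≢ ∷ u) c with f x ℙₚ.≟ f y
    ... | yes x≡y rewrite change-≡ x≡y
      with _ , _ , _ , _ , c₁ , p₁ , c₂ , p₂ , x≢x′ ← 2≤changes⇒consecutive u c =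
      _ , _ , _ , _ , there c₁ , p₁ , there c₂ , p₂ , x≢x′
    ... | no  fx≢fy rewrite change-≢ fx≢fy
      with x′ , y′ , c′ , p ← 1≤changes⇒consecutive (y ∷ l) (ℕₚ.≤-pred c) =
      x , y , x′ , y′ , here , fx≢fy , there c′ , p , All.lookup x≢ (consecutive-∈ˡ c′)

-- Pivots as gaps between consecutive free elements.

module _ {d : ℕ} where

  open DecMembership (Finₚ._≟_ {d}) using (_∈?_; _∉?_)

  consecutive-< : ∀ {x y : Fin d} {l} → AllPairs Fin._<_ l → Consecutive x y l → x Fin.< y
  consecutive-< ((x<y ∷ _) ∷ _) here = x<y
  consecutive-< (_ ∷ ps) (there c)   = consecutive-< ps c

  consecutive-gap : ∀ {x y z : Fin d} {l} → AllPairs Fin._<_ l → Consecutive x y l →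
    z ∈ l → x Fin.< z → ¬ z Fin.< y
  consecutive-gap _ here (here refl) x<z z<y = ℕₚ.<-irrefl refl x<z
  consecutive-gap _ here (there (here refl)) x<z z<y = ℕₚ.<-irrefl refl z<y
  consecutive-gap (_ ∷ y<l ∷ _) here (there (there z∈l)) x<z z<y = ℕₚ.<-asym z<y (All.lookup y<l z∈l)
  consecutive-gap (z<l ∷ _) (there c) (here refl) x<z z<y = ℕₚ.<-asym x<z (All.lookup z<l (consecutive-∈ˡ c))
  consecutive-gap (_ ∷ ps) (there c) (there z∈l) x<z z<y = consecutive-gap ps c z∈l x<z z<y

  -- The walk along the list starts at an element below `a` and stops at the first one above it.
  consecutive-around : ∀ {a z y : Fin d} {l} → a ∉ l → z Fin.< a → y ∈ l → a Fin.< y →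
    ∃₂ λ x′ y′ → Consecutive x′ y′ (z ∷ l) × x′ Fin.< a × a Fin.< y′
  consecutive-around {a} {z} {y} {w ∷ l} a∉ z<a y∈ a<y with Finₚ.<-cmp a w
  ... | tri< a<w _ _ = z , w , here , z<a , a<w
  ... | tri≈ _ a≡w _ = ⊥-elim (a∉ (here a≡w))
  consecutive-around a∉ z<a (here refl) a<y | tri> _ _ w<a = ⊥-elim (ℕₚ.<-asym a<y w<a)
  consecutive-around a∉ z<a (there y∈) a<y | tri> _ _ w<a
    with x′ , y′ , c , p ← consecutive-around (a∉ ∘ there) w<a y∈ a<y = x′ , y′ , there c , p

  consecutive-around-sorted : ∀ {a x y : Fin d} {l} → AllPairs Fin._<_ l → a ∉ l →
    x ∈ l → x Fin.< a → y ∈ l → a Fin.< y →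
    ∃₂ λ x′ y′ → Consecutive x′ y′ l × x′ Fin.< a × a Fin.< y′
  consecutive-around-sorted _ _ (here refl) x<a (here refl) a<y = ⊥-elim (ℕₚ.<-asym x<a a<y)
  consecutive-around-sorted _ a∉ (here refl) x<a (there y∈) a<y = consecutive-around (a∉ ∘ there) x<a y∈ a<y
  consecutive-around-sorted (z<l ∷ _) a∉ (there x∈) x<a (here refl) a<y =
    ⊥-elim (ℕₚ.<-asym (ℕₚ.<-trans (All.lookup z<l x∈) x<a) a<y)
  consecutive-around-sorted (z<l ∷ _) a∉ (there x∈) x<a (there y∈) a<y =
    consecutive-around (a∉ ∘ there) (ℕₚ.<-trans (All.lookup z<l x∈) x<a) y∈ a<y

  interval : Fin d → Fin d → Subset d
  interval x y = tabulate λ z → does ((x Finₚ.<? z) ×-dec (z Finₚ.<? y))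

  ∈-interval : ∀ {x y} z → z Subset.∈ interval x y ⇔ (x Fin.< z × z Fin.< y)
  ∈-interval {x} {y} z = mk⇔
    (λ z∈ → does-true⁻ ((x Finₚ.<? z) ×-dec (z Finₚ.<? y))
      (trans (sym (lookup∘tabulate _ z)) ([]=⇒lookup z∈)))
    (λ p → lookup⇒[]= z (interval x y) (trans (lookup∘tabulate _ z)
      (dec-true ((x Finₚ.<? z) ×-dec (z Finₚ.<? y)) p)))
    where
    does-true⁻ : ∀ {P : Set} (P? : Dec P) → does P? ≡ true → P
    does-true⁻ (yes p) refl = p

  -- An element of `s` above `x` lies either below or above `y`, since `y` itself does not occur.
  greater-split : ∀ {x y : Fin d} s → y ∉ s → x Fin.< y →
    greater s x ≡ countParity (λ z → (x Finₚ.<? z) ×-dec (z Finₚ.<? y)) s ℙ.+ greater s y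
  greater-split [] y∉s x<y = refl
  greater-split {x} {y} (z ∷ s) y∉s x<y = trans
    (cong₂ ℙ._+_ (head-split (Finₚ.<-cmp z y)) (greater-split s (y∉s ∘ there) x<y))
    (interchange (indicator ((x Finₚ.<? z) ×-dec (z Finₚ.<? y))) (indicator (y Finₚ.<? z)) _ _)
    where
    head-split : _ → indicator (x Finₚ.<? z) ≡
      indicator ((x Finₚ.<? z) ×-dec (z Finₚ.<? y)) ℙ.+ indicator (y Finₚ.<? z)
    head-split (tri≈ _ z≡y _) = ⊥-elim (y∉s (here (sym z≡y)))
    head-split (tri> z≮y _ y<z)
      rewrite dec-true (x Finₚ.<? z) (ℕₚ.<-trans x<y y<z) | dec-false (z Finₚ.<? y) z≮y
            | dec-true (y Finₚ.<? z) y<z = refl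
    head-split (tri< z<y _ y≮z)
      rewrite dec-true (z Finₚ.<? y) z<y | dec-false (y Finₚ.<? z) y≮z with does (x Finₚ.<? z)
    ... | true  = refl
    ... | false = refl

  p+q+q≡p : ∀ p q → p ℙ.+ q ℙ.+ q ≡ p
  p+q+q≡p p q = trans (ℙₚ.+-assoc p q q)
    (trans (cong (p ℙ.+_) (ℙₚ.p+p≡0ℙ q)) (ℙₚ.+-identityʳ p))

  -- The elements of `s` above `y` are counted in both bits and cancel.
  interval-parity : ∀ {s x y} {B : Subset d} → Unique s → y ∉ s → x Fin.< y →
    (∀ z → z Subset.∈ B ⇔ (z ∈ s × x Fin.< z × z Fin.< y)) →
    parity ∣ B ∣ ≡ greater s x ℙ.+ greater s y
  interval-parity {s} {x} {y} {B} u y∉s x<y B⇔ = begin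
    parity ∣ B ∣                                        ≡⟨ cong parity (length-elements B) ⟨
    parity (length (elements B))                        ≡⟨ cong parity same-length ⟩
    parity (length (filter between? s))                 ≡⟨ parity-length-filter between? s ⟩
    countParity between? s                              ≡⟨ p+q+q≡p (countParity between? s) (greater s y) ⟨
    countParity between? s ℙ.+ greater s y ℙ.+ greater s y ≡⟨ cong (ℙ._+ greater s y) (greater-split s y∉s x<y) ⟨
    greater s x ℙ.+ greater s y                         ∎
    where
    open ≡-Reasoning
    between? = λ z → (x Finₚ.<? z) ×-dec (z Finₚ.<? y)
    same-length : length (elements B) ≡ length (filter between? s)
    same-length = unique-length (elements-unique B) (Uniqueₚ.filter⁺ between? u) λ z → mk⇔
      (λ z∈ → let z∈s , p = to (B⇔ z) (∈-elements⁻ z∈) in ∈-filter⁺ between? z∈s p)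
      (λ z∈ → ∈-elements⁺ (from (B⇔ z) (∈-filter⁻ between? z∈)))

  odd-nonempty : (B : Subset d) → parity ∣ B ∣ ≡ 1ℙ → Nonempty B
  odd-nonempty B odd with Subsetₚ.nonempty? B
  ... | yes ne = ne
  ... | no ¬ne with () ← trans (sym odd) (cong parity
        (trans (cong ∣_∣ (Subsetₚ.Empty-unique ¬ne)) (Subsetₚ.∣⊥∣≡0 d)))

  ≢⇒+≡1ℙ : ∀ {p q} → p ≢ q → p ℙ.+ q ≡ 1ℙ
  ≢⇒+≡1ℙ {0ℙ} {0ℙ} n = ⊥-elim (n refl)
  ≢⇒+≡1ℙ {0ℙ} {1ℙ} n = refl
  ≢⇒+≡1ℙ {1ℙ} {0ℙ} n = refl
  ≢⇒+≡1ℙ {1ℙ} {1ℙ} n = ⊥-elim (n refl)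

  module _ (s : List (Fin d)) where

    free : List (Fin d)
    free = filter (_∉? s) (allFin d)

    free-sorted : AllPairs Fin._<_ free
    free-sorted = AllPairsₚ.filter⁺ (_∉? s) allFin-sorted

    free-unique : Unique free
    free-unique = Uniqueₚ.filter⁺ (_∉? s) (Uniqueₚ.allFin⁺ d)

    ∈-free⁺ : ∀ {x} → x ∉ s → x ∈ free
    ∈-free⁺ {x} = ∈-filter⁺ (_∉? s) (∈-allFin x)

    ∈-free⁻ : ∀ {x} → x ∈ free → x ∉ s
    ∈-free⁻ x∈ = proj₂ (∈-filter⁻ (_∉? s) {xs = allFin d} x∈)

    length-bits : Unique s → length (bits s) + length s ≡ d
    length-bits u = begin
      length (bits s) + length s ≡⟨ cong (_+ length s) (length-map (greater s) free) ⟩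
      length free + length s     ≡⟨ length-++ free ⟨
      length (free ++ s)         ≡⟨ unique-length
          (Uniqueₚ.++⁺ free-unique u λ (x∈free , x∈s) → ∈-free⁻ x∈free x∈s)
          (Uniqueₚ.allFin⁺ d) (λ z → mk⇔ (λ _ → ∈-allFin z) (λ _ → split z)) ⟩
      length (allFin d)          ≡⟨ length-tabulate (λ i → i) ⟩
      d                          ∎
      where
      open ≡-Reasoning
      split : ∀ z → z ∈ free ++ s
      split z with z ∈? s
      ... | yes z∈s = ∈-++⁺ʳ free z∈s
      ... | no  z∉s = ∈-++⁺ˡ (∈-free⁺ z∉s)

    module _ {x y : Fin d} (c : Consecutive x y free) where

      between-taken : ∀ {z} → x Fin.< z → z Fin.< y → z ∈ s
      between-taken {z} x<z z<y with z ∈? s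
      ... | yes z∈s = z∈s
      ... | no  z∉s = ⊥-elim (consecutive-gap free-sorted c (∈-free⁺ z∉s) x<z z<y)

      -- A class cannot extend past the free elements `x` and `y`, and everything between them is
      -- taken, so the block of `a` fills the gap.
      block-interval : ∀ {a} → x Fin.< a → a Fin.< y →
        ∀ b → (b ∈ s × a ∼[ s ] b) ⇔ (x Fin.< b × b Fin.< y)
      block-interval {a} x<a a<y b = mk⇔ fwd bwd
        where
        fwd : b ∈ s × a ∼[ s ] b → x Fin.< b × b Fin.< y
        fwd (_ , a∼b) =
          ℕₚ.≰⇒> (λ b≤x → ∈-free⁻ (consecutive-∈ˡ c) (a∼b x (inj₂ (b≤x , ℕₚ.<⇒≤ x<a)))) ,
          ℕₚ.≰⇒> (λ y≤b → ∈-free⁻ (consecutive-∈ʳ c) (a∼b y (inj₁ (ℕₚ.<⇒≤ a<y , y≤b))))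
        bwd : x Fin.< b × b Fin.< y → b ∈ s × a ∼[ s ] b
        bwd (x<b , b<y) = between-taken x<b b<y , λ where
          z (inj₁ (a≤z , z≤b)) → between-taken (ℕₚ.<-≤-trans x<a a≤z) (ℕₚ.≤-<-trans z≤b b<y)
          z (inj₂ (b≤z , z≤a)) → between-taken (ℕₚ.<-≤-trans x<b b≤z) (ℕₚ.≤-<-trans z≤a a<y)

      gap-parity : Unique s → ∀ {B} → (∀ z → z Subset.∈ B ⇔ (x Fin.< z × z Fin.< y)) →
        parity ∣ B ∣ ≡ greater s x ℙ.+ greater s y
      gap-parity u B⇔ = interval-parity u (∈-free⁻ (consecutive-∈ʳ c)) (consecutive-< free-sorted c)
        λ z → ⇔-trans (B⇔ z) (mk⇔ (λ (x<z , z<y) → between-taken x<z z<y , x<z , z<y) proj₂)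

      gap⇒pivot : Unique s → greater s x ≢ greater s y → IsPivot s (interval x y)
      gap⇒pivot u δ =
        (a , between-taken x<a a<y ,
          λ b → ⇔-trans (∈-interval b) (⇔-sym (block-interval x<a a<y b))) ,
        odd ,
        x , y , ∈-free⁻ (consecutive-∈ˡ c) , ∈-free⁻ (consecutive-∈ʳ c) , (λ b → to (∈-interval b))
        where
        odd : parity ∣ interval x y ∣ ≡ 1ℙ
        odd = trans (gap-parity u ∈-interval) (≢⇒+≡1ℙ δ)
        -- An odd set is nonempty, which yields the representative that `IsBlock` asks for.
        ne = odd-nonempty (interval x y) odd
        a = proj₁ ne
        x<a = proj₁ (to (∈-interval {x} {y} a) (proj₂ ne))
        a<y = proj₂ (to (∈-interval {x} {y} a) (proj₂ ne))

    -- The free elements given by `IsPivot` may be far from the block; they are replaced by the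
    -- consecutive free elements around `a`. Equal bits there would make the block even.
    pivot⇒gap : Unique s → ∀ {B} → IsPivot s B →
      ∃₂ λ x y → Consecutive x y free × greater s x ≢ greater s y × B ≡ interval x y
    pivot⇒gap u {B} ((a , a∈s , B⇔) , odd , x₀ , y₀ , x₀∉s , y₀∉s , x₀<B<y₀)
      with x₀<a , a<y₀ ← x₀<B<y₀ a (from (B⇔ a) (a∈s , λ where
             z (inj₁ (a≤z , z≤a)) → subst (_∈ s) (Finₚ.≤-antisym a≤z z≤a) a∈s
             z (inj₂ (a≤z , z≤a)) → subst (_∈ s) (Finₚ.≤-antisym a≤z z≤a) a∈s))
      with x , y , c , x<a , a<y ← consecutive-around-sorted free-sorted (λ a∈ → ∈-free⁻ a∈ a∈s)
             (∈-free⁺ x₀∉s) x₀<a (∈-free⁺ y₀∉s) a<y₀ =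
      x , y , c ,
      (λ eq → contradict (trans (sym odd) (trans (gap-parity c u B⇔′)
        (trans (cong (ℙ._+ greater s y) eq) (ℙₚ.p+p≡0ℙ (greater s y)))))) ,
      Subsetₚ.⊆-antisym (λ {z} → from (∈-interval z) ∘ to (B⇔′ z)) (λ {z} → from (B⇔′ z) ∘ to (∈-interval z))
      where
      B⇔′ : ∀ z → z Subset.∈ B ⇔ (x Fin.< z × z Fin.< y)
      B⇔′ z = ⇔-trans (B⇔ z) (block-interval c x<a a<y z)
      contradict : 1ℙ ≢ 0ℙ
      contradict ()

    -- Empty gaps all give the same subset, hence the common element `z`. If the left ends differed,
    -- the larger one would be free and strictly inside the other gap.
    interval-injective : ∀ {x y x′ y′} → Consecutive x y free → Consecutive x′ y′ free →
      Nonempty (interval x y) → interval x y ≡ interval x′ y′ → x ≡ x′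
    interval-injective {x} {y} {x′} {y′} c c′ (z , z∈) eq
      with x<z , z<y ← to (∈-interval z) z∈
      with x′<z , z<y′ ← to (∈-interval z) (subst (z Subset.∈_) eq z∈)
      with Finₚ.<-cmp x x′
    ... | tri< x<x′ _ _ = ⊥-elim (consecutive-gap free-sorted c (consecutive-∈ˡ c′) x<x′ (ℕₚ.<-trans x′<z z<y))
    ... | tri≈ _ x≡x′ _ = x≡x′
    ... | tri> _ _ x′<x = ⊥-elim (consecutive-gap free-sorted c′ (consecutive-∈ˡ c) x′<x (ℕₚ.<-trans x<z z<y′))

    noPivot⇒changes≡0 : Unique s → NoPivot s → changes (bits s) ≡ 0
    noPivot⇒changes≡0 u ¬pivot = ℕₚ.n<1⇒n≡0 (ℕₚ.≰⇒> λ 1≤c →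
      let x , y , c , δ = 1≤changes⇒consecutive (greater s) free 1≤c
      in ¬pivot (_ , gap⇒pivot c u δ))

    pivot⇒1≤changes : Unique s → ∀ {B} → IsPivot s B → 1 ≤ changes (bits s)
    pivot⇒1≤changes u pivot =
      let _ , _ , c , δ , _ = pivot⇒gap u pivot in consecutive⇒1≤changes (greater s) c δ

    exactlyOnePivot⇒changes≤1 : Unique s → ExactlyOnePivot s → changes (bits s) ≤ 1
    exactlyOnePivot⇒changes≤1 u (_ , _ , unique) = ℕₚ.≮⇒≥ λ 2≤c →
      let _ , _ , _ , _ , c , δ , c′ , δ′ , x≢x′ = 2≤changes⇒consecutive (greater s) free-unique 2≤c
          pivot  = gap⇒pivot c u δ
          pivot′ = gap⇒pivot c′ u δ′
      in x≢x′ (interval-injective c c′ (odd-nonempty _ (proj₁ (proj₂ pivot)))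
           (trans (sym (unique pivot)) (unique pivot′)))

    moreThanOnePivot⇒2≤changes : Unique s → MoreThanOnePivot s → 2 ≤ changes (bits s)
    moreThanOnePivot⇒2≤changes u (_ , _ , B≢C , pivot , pivot′) =
      let _ , _ , c , δ , B≡ = pivot⇒gap u pivot
          _ , _ , c′ , δ′ , C≡ = pivot⇒gap u pivot′
      in consecutive⇒2≤changes (greater s) c δ c′ δ′ λ (x≡x′ , y≡y′) →
           B≢C (trans B≡ (trans (cong₂ interval x≡x′ y≡y′) (sym C≡)))

theorem2p1 : ∀ (d m n : ℕ) → .{{_ : NonZero n}} →
    (s : List (Fin d)) → length s ≡ m → Unique s →
    d ≥ m + n →
    (goal : Player → Parity) → goal Black ≢ goal White →
    (d ≡ m + n → n ≥ 2 → Wins goal White n s)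
    ×
    (d > m + n + 1 →
    (NoPivot s → n ≥ 2 → Wins goal White n s)
    × (ExactlyOnePivot s → Wins goal (firstPlayer n) n s)
    × (MoreThanOnePivot s → Wins goal Black n s))
theorem2p1 d m (suc k) s refl u _ goal _ =
  (λ d≡ 2≤n → wins (white-forces-full-board goal k (ℕₚ.≤-pred 2≤n)
    (ℕₚ.+-cancelʳ-≡ m _ _ (trans (length-bits s u) (trans d≡ (ℕₚ.+-comm m (suc k))))))) ,
  λ d> →
    -- At least two more elements are free than there are turns: the surplus of bits that Black's
    -- strategy uses.
    let many : suc k + 2 ≤ length (bits s)
        many = ℕₚ.+-cancelʳ-≤ m _ _ (subst (suc k + 2 + m ≤_) (sym (length-bits s u))
          (subst (_≤ d) (count k) d>))
        enough = ℕₚ.≤-trans (ℕₚ.m≤m+n (suc k) 2) many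
    in
    (λ none 2≤n → no-pivot enough (ℕₚ.≤-pred 2≤n) (noPivot⇒changes≡0 s u none)) ,
    (λ one@(_ , pivot , _) →
      one-pivot many enough (pivot⇒1≤changes s u pivot) (exactlyOnePivot⇒changes≤1 s u one)) ,
    (λ more → more-pivots many (moreThanOnePivot⇒2≤changes s u more))
  where
  wins : ∀ {P} → Forces goal P (suc k) (inversions s) (bits s) → Wins goal P (suc k) s
  wins f = Winning⇒Wins goal _ (Forces⇒Winning s refl refl f)

  count : ∀ k → suc (m + suc k + 1) ≡ suc k + 2 + m
  count k = trans (sym (ℕₚ.+-suc (m + suc k) 1)) (trans (ℕₚ.+-assoc m (suc k) 2) (ℕₚ.+-comm m (suc k + 2)))

  no-pivot : suc k ≤ length (bits s) → 1 ≤ k → changes (bits s) ≡ 0 → Wins goal White (suc k) s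
  no-pivot l 1≤k c with mover k in eq
  ... | Black = wins (white-forces-moving-second goal k eq 1≤k l c)
  ... | White = wins (white-forces-moving-first goal k eq l (subst (_≤ 1) (sym c) z≤n))

  one-pivot : suc k + 2 ≤ length (bits s) → suc k ≤ length (bits s) →
    1 ≤ changes (bits s) → changes (bits s) ≤ 1 → Wins goal (mover k) (suc k) s
  one-pivot l l′ c c′ with mover k in eq
  ... | Black = wins (black-forces-moving-first goal k eq l c)
  ... | White = wins (white-forces-moving-first goal k eq l′ c′)

  more-pivots : suc k + 2 ≤ length (bits s) → 2 ≤ changes (bits s) → Wins goal Black (suc k) s
  more-pivots l c with mover k in eq
  ... | Black = wins (black-forces-moving-first goal k eq l (ℕₚ.<⇒≤ c))
  ... | White = wins (black-forces-moving-second goal k eq l c)
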